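{- Let $c>0$. In the semi-oblivious cup game with additive error $c$ on $n$ cups, the greedy algorithm achieves backlog $(c+1)\ln n+O(c+1)$; that is, there is an absolute constant $C$ such that for all $c>0$ and $n\ge 1$, against every adversary strategy (including every choice of estimates), the backlog is at most $(c+1)\ln n+C(c+1)$.
   Context: Semi-oblivious cup game with additive error $c>0$. There are $n$ cups, initially empty; heights are nonnegative reals. Time proceeds in discrete steps. In each step the adversary first distributes $1$ unit of water among the cups arbitrarily (nonnegative amounts summing to $1$), resulting in intermediate heights $g_1(t),\dots,g_n(t)$. The adversary then shows the player estimates $g_i'(t)\in[g_i(t),\,g_i(t)+c]$ for each cup $i$, of the adversary's choice. The player then selects one cup and removes up to $1$ unit of water from it: if cup $i$ is selected, its height becomes $\max(g_i(t)-1,0)$, and all other heights are unchanged. The adversary may be adaptive. Greedy algorithm: the player always selects a cup $i$ with maximal estimate $g_i'(t)$, ties broken arbitrarily (the worst case includes worst-case tie-breaking). Backlog: the supremum over all time steps (including the intermediate moment after the adversary's move) of the height of the fullest cup. -}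

module Defs where

open import Data.Fin.Base using (Fin)
open import Data.Integer.Base as ℤ using (+_; -[1+_])
import Data.Integer.Properties as ℤ
import Data.Integer.Tactic.RingSolver as ℤSolver
open import Data.Nat.Base as ℕ using (ℕ; zero; suc; NonZero)
import Data.Nat.Properties as ℕ
import Data.Nat.Tactic.RingSolver as ℕSolver
open import Data.Product.Base using (∃; _×_; _,_)
open import Data.Rational.Base as ℚ using (ℚ; mkℚ; 0ℚ; 1ℚ; ½)
import Data.Rational.Properties as ℚ
open import Data.Rational.Solver using (module +-*-Solver)
open import Data.Rational.Unnormalised.Base as ℚᵘ using (mkℚᵘ)
import Data.Rational.Unnormalised.Properties as ℚᵘ
open import Data.Sum.Base using (inj₁; inj₂)
open import Data.Vec.Functional using (Vector; foldr; updateAt)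
open import Relation.Binary.PropositionalEquality
  using (_≡_; refl; sym; trans; cong; cong₂; subst; subst₂)

private
  open +-*-Solver using (solve; _:=_; _:+_; _:*_; _:-_; :-_; con)

  p≤∣p∣ : ∀ p → p ℚ.≤ ℚ.∣ p ∣
  p≤∣p∣ p with ℚ.≤-total 0ℚ p
  ... | inj₁ 0≤p = ℚ.≤-reflexive (sym (ℚ.0≤p⇒∣p∣≡p 0≤p))
  ... | inj₂ p≤0 = ℚ.≤-trans p≤0 (ℚ.0≤∣p∣ p)

  +-rotate : ∀ p q e → p ℚ.- q ℚ.≤ e → p ℚ.≤ q ℚ.+ e
  +-rotate p q e h = subst (ℚ._≤ q ℚ.+ e)
    (solve 2 (λ x y → y :+ (x :- y) := x) refl p q) (ℚ.+-monoʳ-≤ q h)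

  +-unrotate : ∀ p q e → p ℚ.≤ q ℚ.+ e → p ℚ.- q ℚ.≤ e
  +-unrotate p q e h = subst (p ℚ.- q ℚ.≤_)
    (solve 2 (λ y z → (y :+ z) :- y := z) refl q e) (ℚ.+-monoˡ-≤ (ℚ.- q) h)

  dist-sym : ∀ p q → ℚ.∣ p ℚ.- q ∣ ≡ ℚ.∣ q ℚ.- p ∣
  dist-sym p q = trans (sym (ℚ.∣-p∣≡∣p∣ (p ℚ.- q)))
    (cong ℚ.∣_∣ (solve 2 (λ x y → :- (x :- y) := y :- x) refl p q))

  dist-elim : ∀ p q {e} → ℚ.∣ p ℚ.- q ∣ ℚ.≤ e → p ℚ.≤ q ℚ.+ e
  dist-elim p q h = +-rotate p q _ (ℚ.≤-trans (p≤∣p∣ (p ℚ.- q)) h)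

  dist-elim′ : ∀ p q {e} → ℚ.∣ p ℚ.- q ∣ ℚ.≤ e → q ℚ.≤ p ℚ.+ e
  dist-elim′ p q h = dist-elim q p (subst (ℚ._≤ _) (dist-sym p q) h)

  dist-intro : ∀ p q {e} → p ℚ.≤ q ℚ.+ e → q ℚ.≤ p ℚ.+ e → ℚ.∣ p ℚ.- q ∣ ℚ.≤ e
  dist-intro p q {e} h h′ with ℚ.∣p∣≡p∨∣p∣≡-p (p ℚ.- q)
  ... | inj₁ eq = subst (ℚ._≤ e) (sym eq) (+-unrotate p q e h)
  ... | inj₂ eq = subst (ℚ._≤ e)
    (sym (trans eq (solve 2 (λ x y → :- (x :- y) := y :- x) refl p q)))
    (+-unrotate q p e h′)

  ½-pos : ∀ {ε} → 0ℚ ℚ.< ε → 0ℚ ℚ.< ½ ℚ.* ε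
  ½-pos {ε} 0<ε = subst (ℚ._< ½ ℚ.* ε) (ℚ.*-zeroʳ ½) (ℚ.*-monoʳ-<-pos ½ 0<ε)

  ½+½ : ∀ ε → ½ ℚ.* ε ℚ.+ ½ ℚ.* ε ≡ ε
  ½+½ = solve 1 (λ e → con ½ :* e :+ con ½ :* e := e) refl

  ⊔-perturb : ∀ p q p′ q′ e → p ℚ.≤ p′ ℚ.+ e → q ℚ.≤ q′ ℚ.+ e →
              p ℚ.⊔ q ℚ.≤ p′ ℚ.⊔ q′ ℚ.+ e
  ⊔-perturb p q p′ q′ e h k = ℚ.⊔-lub
    (ℚ.≤-trans h (ℚ.+-monoˡ-≤ e (ℚ.p≤p⊔q p′ q′)))
    (ℚ.≤-trans k (ℚ.+-monoˡ-≤ e (ℚ.p≤q⊔p p′ q′)))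

  *-mono-≤ : ∀ {p q r s} → 0ℚ ℚ.≤ r → 0ℚ ℚ.≤ q → p ℚ.≤ q → r ℚ.≤ s →
             p ℚ.* r ℚ.≤ q ℚ.* s
  *-mono-≤ {p} {q} {r} {s} 0≤r 0≤q p≤q r≤s = ℚ.≤-trans
    (ℚ.*-monoʳ-≤-nonNeg r {{ℚ.nonNegative 0≤r}} p≤q)
    (ℚ.*-monoˡ-≤-nonNeg q {{ℚ.nonNegative 0≤q}} r≤s)

-- Real numbers, as Cauchy sequences of rationals compared by the setoid
-- equality _≃_; all operations act pointwise on sequences.

Eventually : (ℕ → Set) → Set
Eventually P = ∃ λ N → ∀ n → N ℕ.≤ n → P n

Cauchy : (ℕ → ℚ) → Set
Cauchy f = ∀ ε → 0ℚ ℚ.< ε →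
  ∃ λ N → ∀ m n → N ℕ.≤ m → N ℕ.≤ n → ℚ.∣ f m ℚ.- f n ∣ ℚ.≤ ε

record ℝ : Set where
  constructor mkℝ
  field
    seq    : ℕ → ℚ
    cauchy : Cauchy seq

open ℝ public

infix  4 _≤_ _<_ _≃_
infixl 6 _+_ _-_
infixl 6 _⊔_
infixl 7 _*_
infix  8 -_

record _≤_ (x y : ℝ) : Set where
  constructor mk≤
  field
    eventually≤ : ∀ ε → 0ℚ ℚ.< ε → Eventually λ n → seq x n ℚ.≤ seq y n ℚ.+ ε

record _<_ (x y : ℝ) : Set where
  constructor mk<
  field
    gap         : ℚ
    gap-pos     : 0ℚ ℚ.< gap
    eventually< : Eventually λ n → seq x n ℚ.+ gap ℚ.≤ seq y n

open _≤_ public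
open _<_ public

_≃_ : ℝ → ℝ → Set
x ≃ y = x ≤ y × y ≤ x

private
  abstract
    const-cauchy : ∀ q → Cauchy (λ _ → q)
    const-cauchy q ε 0<ε = 0 , λ _ _ _ _ → dist-intro q q q≤q+ε q≤q+ε
      where
      q≤q+ε : q ℚ.≤ q ℚ.+ ε
      q≤q+ε = subst (ℚ._≤ q ℚ.+ ε) (ℚ.+-identityʳ q)
        (ℚ.+-monoʳ-≤ q (ℚ.<⇒≤ 0<ε))

fromℚ : ℚ → ℝ
fromℚ q = mkℝ (λ _ → q) (const-cauchy q)

0ℝ 1ℝ : ℝ
0ℝ = fromℚ 0ℚ
1ℝ = fromℚ 1ℚ

private
  abstract
    +-cauchy : ∀ {f g} → Cauchy f → Cauchy g → Cauchy (λ n → f n ℚ.+ g n)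
    +-cauchy {f} {g} F G ε 0<ε with F (½ ℚ.* ε) (½-pos 0<ε) | G (½ ℚ.* ε) (½-pos 0<ε)
    ... | M , hM | N , hN = M ℕ.⊔ N , λ m n m≥ n≥ →
      let open ℚ.≤-Reasoning in begin
        ℚ.∣ (f m ℚ.+ g m) ℚ.- (f n ℚ.+ g n) ∣
          ≡⟨ cong ℚ.∣_∣ (solve 4 (λ a b c d → (a :+ b) :- (c :+ d) := (a :- c) :+ (b :- d))
                                 refl (f m) (g m) (f n) (g n)) ⟩
        ℚ.∣ (f m ℚ.- f n) ℚ.+ (g m ℚ.- g n) ∣
          ≤⟨ ℚ.∣p+q∣≤∣p∣+∣q∣ (f m ℚ.- f n) (g m ℚ.- g n) ⟩
        ℚ.∣ f m ℚ.- f n ∣ ℚ.+ ℚ.∣ g m ℚ.- g n ∣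
          ≤⟨ ℚ.+-mono-≤ (hM m n (ℕ.m⊔n≤o⇒m≤o M N m≥) (ℕ.m⊔n≤o⇒m≤o M N n≥))
                        (hN m n (ℕ.m⊔n≤o⇒n≤o M N m≥) (ℕ.m⊔n≤o⇒n≤o M N n≥)) ⟩
        ½ ℚ.* ε ℚ.+ ½ ℚ.* ε ≡⟨ ½+½ ε ⟩
        ε ∎

    neg-cauchy : ∀ {f} → Cauchy f → Cauchy (λ n → ℚ.- f n)
    neg-cauchy {f} F ε 0<ε with F ε 0<ε
    ... | N , h = N , λ m n m≥ n≥ → subst (ℚ._≤ ε)
      (trans (dist-sym (f m) (f n)) (cong ℚ.∣_∣
        (solve 2 (λ x y → y :- x := (:- x) :- (:- y)) refl (f m) (f n))))
      (h m n m≥ n≥)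

    ⊔-cauchy : ∀ {f g} → Cauchy f → Cauchy g → Cauchy (λ n → f n ℚ.⊔ g n)
    ⊔-cauchy {f} {g} F G ε 0<ε with F ε 0<ε | G ε 0<ε
    ... | M , hM | N , hN = M ℕ.⊔ N , λ m n m≥ n≥ →
      let F≤ = hM m n (ℕ.m⊔n≤o⇒m≤o M N m≥) (ℕ.m⊔n≤o⇒m≤o M N n≥)
          G≤ = hN m n (ℕ.m⊔n≤o⇒n≤o M N m≥) (ℕ.m⊔n≤o⇒n≤o M N n≥)
      in dist-intro (f m ℚ.⊔ g m) (f n ℚ.⊔ g n)
           (⊔-perturb (f m) (g m) (f n) (g n) ε
             (dist-elim (f m) (f n) F≤) (dist-elim (g m) (g n) G≤))
           (⊔-perturb (f n) (g n) (f m) (g m) ε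
             (dist-elim′ (f m) (f n) F≤) (dist-elim′ (g m) (g n) G≤))

    product-diff : ∀ a b c d →
      a ℚ.* b ℚ.- c ℚ.* d ≡ a ℚ.* (b ℚ.- d) ℚ.+ d ℚ.* (a ℚ.- c)
    product-diff = solve 4
      (λ a b c d → a :* b :- c :* d := a :* (b :- d) :+ d :* (a :- c)) refl

    cauchy⇒bounded : ∀ {f} → Cauchy f →
      ∃ λ B → 0ℚ ℚ.≤ B × Eventually λ n → ℚ.∣ f n ∣ ℚ.≤ B
    cauchy⇒bounded {f} F with F 1ℚ (ℚ.positive⁻¹ 1ℚ)
    ... | N , h = 1ℚ ℚ.+ ℚ.∣ f N ∣
      , ℚ.+-mono-≤ (ℚ.nonNegative⁻¹ 1ℚ) (ℚ.0≤∣p∣ (f N))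
      , N , λ n n≥ → let open ℚ.≤-Reasoning in begin
        ℚ.∣ f n ∣
          ≡⟨ cong ℚ.∣_∣ (solve 2 (λ x y → x := (x :- y) :+ y) refl (f n) (f N)) ⟩
        ℚ.∣ (f n ℚ.- f N) ℚ.+ f N ∣
          ≤⟨ ℚ.∣p+q∣≤∣p∣+∣q∣ (f n ℚ.- f N) (f N) ⟩
        ℚ.∣ f n ℚ.- f N ∣ ℚ.+ ℚ.∣ f N ∣
          ≤⟨ ℚ.+-monoˡ-≤ ℚ.∣ f N ∣ (h n N n≥ ℕ.≤-refl) ⟩
        1ℚ ℚ.+ ℚ.∣ f N ∣ ∎

    shrink : ∀ B ε → 0ℚ ℚ.≤ B → 0ℚ ℚ.< ε → ∃ λ δ → 0ℚ ℚ.< δ × B ℚ.* δ ℚ.≤ ε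
    shrink B ε 0≤B 0<ε = δ , 0<δ , Bδ≤ε
      where
      D : ℚ
      D = 1ℚ ℚ.+ B
      0<D : 0ℚ ℚ.< D
      0<D = ℚ.+-mono-<-≤ (ℚ.positive⁻¹ 1ℚ) 0≤B
      instance
        D-pos : ℚ.Positive D
        D-pos = ℚ.positive 0<D
        D≢0 : ℚ.NonZero D
        D≢0 = ℚ.pos⇒nonZero D
      I : ℚ
      I = ℚ.1/ D
      instance
        I-pos : ℚ.Positive I
        I-pos = ℚ.1/pos⇒pos D
      δ : ℚ
      δ = I ℚ.* ε
      0<δ : 0ℚ ℚ.< δ
      0<δ = subst (ℚ._< δ) (ℚ.*-zeroʳ I) (ℚ.*-monoʳ-<-pos I 0<ε)
      B≤D : B ℚ.≤ D
      B≤D = subst (ℚ._≤ D) (ℚ.+-identityˡ B) (ℚ.+-monoˡ-≤ B (ℚ.nonNegative⁻¹ 1ℚ))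
      Dδ≡ε : D ℚ.* δ ≡ ε
      Dδ≡ε = trans (sym (ℚ.*-assoc D I ε))
        (trans (cong (ℚ._* ε) (ℚ.*-inverseʳ D)) (ℚ.*-identityˡ ε))
      Bδ≤ε : B ℚ.* δ ℚ.≤ ε
      Bδ≤ε = subst (B ℚ.* δ ℚ.≤_) Dδ≡ε
        (ℚ.*-monoʳ-≤-nonNeg δ {{ℚ.nonNegative (ℚ.<⇒≤ 0<δ)}} B≤D)

    product-close : ∀ a b c d {A B α β ε} → 0ℚ ℚ.≤ A → 0ℚ ℚ.≤ B →
      ℚ.∣ a ∣ ℚ.≤ A → ℚ.∣ d ∣ ℚ.≤ B → ℚ.∣ b ℚ.- d ∣ ℚ.≤ α → ℚ.∣ a ℚ.- c ∣ ℚ.≤ β →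
      A ℚ.* α ℚ.≤ ½ ℚ.* ε → B ℚ.* β ℚ.≤ ½ ℚ.* ε →
      ℚ.∣ a ℚ.* b ℚ.- c ℚ.* d ∣ ℚ.≤ ε
    product-close a b c d {A} {B} {α} {β} {ε} 0≤A 0≤B a≤A d≤B bd≤α ac≤β Aα≤ Bβ≤ = begin
      ℚ.∣ a ℚ.* b ℚ.- c ℚ.* d ∣
        ≡⟨ cong ℚ.∣_∣ (product-diff a b c d) ⟩
      ℚ.∣ a ℚ.* (b ℚ.- d) ℚ.+ d ℚ.* (a ℚ.- c) ∣
        ≤⟨ ℚ.∣p+q∣≤∣p∣+∣q∣ (a ℚ.* (b ℚ.- d)) (d ℚ.* (a ℚ.- c)) ⟩
      ℚ.∣ a ℚ.* (b ℚ.- d) ∣ ℚ.+ ℚ.∣ d ℚ.* (a ℚ.- c) ∣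
        ≡⟨ cong₂ ℚ._+_ (ℚ.∣p*q∣≡∣p∣*∣q∣ a (b ℚ.- d)) (ℚ.∣p*q∣≡∣p∣*∣q∣ d (a ℚ.- c)) ⟩
      ℚ.∣ a ∣ ℚ.* ℚ.∣ b ℚ.- d ∣ ℚ.+ ℚ.∣ d ∣ ℚ.* ℚ.∣ a ℚ.- c ∣
        ≤⟨ ℚ.+-mono-≤ (*-mono-≤ (ℚ.0≤∣p∣ (b ℚ.- d)) 0≤A a≤A bd≤α)
                      (*-mono-≤ (ℚ.0≤∣p∣ (a ℚ.- c)) 0≤B d≤B ac≤β) ⟩
      A ℚ.* α ℚ.+ B ℚ.* β
        ≤⟨ ℚ.+-mono-≤ Aα≤ Bβ≤ ⟩
      ½ ℚ.* ε ℚ.+ ½ ℚ.* ε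
        ≡⟨ ½+½ ε ⟩
      ε ∎
      where open ℚ.≤-Reasoning

    *-cauchy : ∀ {f g} → Cauchy f → Cauchy g → Cauchy (λ n → f n ℚ.* g n)
    *-cauchy {f} {g} F G ε 0<ε =
      let A , 0≤A , K , hA = cauchy⇒bounded {f} F
          B , 0≤B , L , hB = cauchy⇒bounded {g} G
          α , 0<α , Aα≤    = shrink A (½ ℚ.* ε) 0≤A (½-pos 0<ε)
          β , 0<β , Bβ≤    = shrink B (½ ℚ.* ε) 0≤B (½-pos 0<ε)
          M , hM           = F β 0<β
          N , hN           = G α 0<α
      in combine {A = A} {B} {α} {β} 0≤A 0≤B hA hB hM hN Aα≤ Bβ≤
      where
      combine : ∀ {A B α β K L M N} → 0ℚ ℚ.≤ A → 0ℚ ℚ.≤ B →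
        (∀ n → K ℕ.≤ n → ℚ.∣ f n ∣ ℚ.≤ A) →
        (∀ n → L ℕ.≤ n → ℚ.∣ g n ∣ ℚ.≤ B) →
        (∀ m n → M ℕ.≤ m → M ℕ.≤ n → ℚ.∣ f m ℚ.- f n ∣ ℚ.≤ β) →
        (∀ m n → N ℕ.≤ m → N ℕ.≤ n → ℚ.∣ g m ℚ.- g n ∣ ℚ.≤ α) →
        A ℚ.* α ℚ.≤ ½ ℚ.* ε → B ℚ.* β ℚ.≤ ½ ℚ.* ε →
        ∃ λ N₀ → ∀ m n → N₀ ℕ.≤ m → N₀ ℕ.≤ n → ℚ.∣ f m ℚ.* g m ℚ.- f n ℚ.* g n ∣ ℚ.≤ ε
      combine {K = K} {L} {M} {N} 0≤A 0≤B hA hB hM hN Aα≤ Bβ≤ =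
        (K ℕ.⊔ L) ℕ.⊔ (M ℕ.⊔ N) , λ m n m≥ n≥ →
        let m≥₁ = ℕ.m⊔n≤o⇒m≤o (K ℕ.⊔ L) (M ℕ.⊔ N) m≥
            m≥₂ = ℕ.m⊔n≤o⇒n≤o (K ℕ.⊔ L) (M ℕ.⊔ N) m≥
            n≥₁ = ℕ.m⊔n≤o⇒m≤o (K ℕ.⊔ L) (M ℕ.⊔ N) n≥
            n≥₂ = ℕ.m⊔n≤o⇒n≤o (K ℕ.⊔ L) (M ℕ.⊔ N) n≥
        in product-close (f m) (g m) (f n) (g n) 0≤A 0≤B
             (hA m (ℕ.m⊔n≤o⇒m≤o K L m≥₁))
             (hB n (ℕ.m⊔n≤o⇒n≤o K L n≥₁))
             (hN m n (ℕ.m⊔n≤o⇒n≤o M N m≥₂) (ℕ.m⊔n≤o⇒n≤o M N n≥₂))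
             (hM m n (ℕ.m⊔n≤o⇒m≤o M N m≥₂) (ℕ.m⊔n≤o⇒m≤o M N n≥₂))
             Aα≤ Bβ≤

_+_ : ℝ → ℝ → ℝ
x + y = mkℝ (λ n → seq x n ℚ.+ seq y n) (+-cauchy {seq x} {seq y} (cauchy x) (cauchy y))

-_ : ℝ → ℝ
- x = mkℝ (λ n → ℚ.- seq x n) (neg-cauchy {seq x} (cauchy x))

_-_ : ℝ → ℝ → ℝ
x - y = x + (- y)

_*_ : ℝ → ℝ → ℝ
x * y = mkℝ (λ n → seq x n ℚ.* seq y n) (*-cauchy {seq x} {seq y} (cauchy x) (cauchy y))

_⊔_ : ℝ → ℝ → ℝ
x ⊔ y = mkℝ (λ n → seq x n ℚ.⊔ seq y n) (⊔-cauchy {seq x} {seq y} (cauchy x) (cauchy y))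

-- recipSum a l = 1/(a+1) + 1/(a+2) + ⋯ + 1/(a+l)
recipSum : ℕ → ℕ → ℚ
recipSum a zero    = 0ℚ
recipSum a (suc l) = recipSum a l ℚ.+ + 1 ℚ./ suc (a ℕ.+ l)

-- lnApprox p k is the right-endpoint Riemann sum of ∫ dx/x over [1, 1 + p]
-- with mesh 1/s, where s = k + 1:
--   ∑_{j=1}^{ps} (1/s) · 1/(1 + j/s)  =  ∑_{j=1}^{ps} 1/(s + j).
lnApprox : ℕ → ℕ → ℚ
lnApprox p k = recipSum (suc k) (p ℕ.* suc k)

private
  frac : ℕ → ℕ → ℚ
  frac m d = + m ℚ./ suc d

  recip : ℕ → ℚ
  recip = frac 1

  recip-antitone : ∀ {d e} → d ℕ.≤ e → recip e ℚ.≤ recip d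
  recip-antitone {d} {e} d≤e = ℚ.toℚᵘ-cancel-≤
    (ℚᵘ.≤-respˡ-≃ (ℚᵘ.≃-sym (ℚ.toℚᵘ-fromℚᵘ (mkℚᵘ (+ 1) e)))
      (ℚᵘ.≤-respʳ-≃ (ℚᵘ.≃-sym (ℚ.toℚᵘ-fromℚᵘ (mkℚᵘ (+ 1) d)))
        (ℚᵘ.*≤* (ℤ.*-monoˡ-≤-nonNeg (+ 1) (ℤ.+≤+ (ℕ.s≤s d≤e))))))

  frac-suc : ∀ m d → frac m d ℚ.+ recip d ≡ frac (suc m) d
  frac-suc m d = ℚ.toℚᵘ-injective
    (ℚᵘ.≃-trans (ℚ.toℚᵘ-homo-+ (frac m d) (recip d))
    (ℚᵘ.≃-trans (ℚᵘ.+-cong (ℚ.toℚᵘ-fromℚᵘ (mkℚᵘ (+ m) d))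
                           (ℚ.toℚᵘ-fromℚᵘ (mkℚᵘ (+ 1) d)))
    (ℚᵘ.≃-trans (ℚᵘ.*≡* (lemma (+ m) (+ suc d)))
                (ℚᵘ.≃-sym (ℚ.toℚᵘ-fromℚᵘ (mkℚᵘ (+ suc m) d))))))
    where
    lemma : ∀ x y → (x ℤ.* y ℤ.+ + 1 ℤ.* y) ℤ.* y ≡ (+ 1 ℤ.+ x) ℤ.* (y ℤ.* y)
    lemma = ℤSolver.solve-∀

  frac-zero : ∀ d → frac 0 d ≡ 0ℚ
  frac-zero d = ℚ.fromℚᵘ-cong {mkℚᵘ (+ 0) d} {mkℚᵘ (+ 0) 0} (ℚᵘ.*≡* refl)

  frac-cancel : ∀ p a → frac (suc p) (p ℕ.+ a ℕ.* suc p) ≡ recip a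
  frac-cancel p a = ℚ.fromℚᵘ-cong
    {mkℚᵘ (+ suc p) (p ℕ.+ a ℕ.* suc p)} {mkℚᵘ (+ 1) a}
    (ℚᵘ.*≡* (cong +_ (lemma p a)))
    where
    lemma : ∀ p a → suc p ℕ.* suc a ≡ 1 ℕ.* suc (p ℕ.+ a ℕ.* suc p)
    lemma = ℕSolver.solve-∀

  recipSum-lower : ∀ b l e → b ℕ.+ l ℕ.≤ suc e → frac l e ℚ.≤ recipSum b l
  recipSum-lower b zero    e h = ℚ.≤-reflexive (frac-zero e)
  recipSum-lower b (suc l) e h = subst (ℚ._≤ recipSum b (suc l)) (frac-suc l e)
    (ℚ.+-mono-≤ (recipSum-lower b l e (ℕ.≤-trans (ℕ.n≤1+n (b ℕ.+ l)) h′))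
                (recip-antitone (ℕ.s≤s⁻¹ h′)))
    where
    h′ : suc (b ℕ.+ l) ℕ.≤ suc e
    h′ = subst (ℕ._≤ suc e) (ℕ.+-suc b l) h

  recipSum-upper : ∀ b l e → e ℕ.≤ b → recipSum b l ℚ.≤ frac l e
  recipSum-upper b zero    e h = ℚ.≤-reflexive (sym (frac-zero e))
  recipSum-upper b (suc l) e h = subst (recipSum b (suc l) ℚ.≤_) (frac-suc l e)
    (ℚ.+-mono-≤ (recipSum-upper b l e h)
                (recip-antitone (ℕ.≤-trans h (ℕ.m≤m+n b l))))

  recipSum-++ : ∀ a l q → recipSum a (l ℕ.+ q) ≡ recipSum a l ℚ.+ recipSum (a ℕ.+ l) q
  recipSum-++ a l zero    = trans (cong (recipSum a) (ℕ.+-identityʳ l))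
                                  (sym (ℚ.+-identityʳ (recipSum a l)))
  recipSum-++ a l (suc q) = trans (cong (recipSum a) (ℕ.+-suc l q))
    (trans (cong₂ ℚ._+_ (recipSum-++ a l q) (cong recip (sym (ℕ.+-assoc a l q))))
           (ℚ.+-assoc (recipSum a l) (recipSum (a ℕ.+ l) q) (recip (a ℕ.+ l ℕ.+ q))))

  recipSum-head : ∀ a l → recipSum a (1 ℕ.+ l) ≡ recip a ℚ.+ recipSum (suc a) l
  recipSum-head a l = trans (recipSum-++ a 1 l) (cong₂ ℚ._+_
    (trans (ℚ.+-identityˡ (recip (a ℕ.+ 0))) (cong recip (ℕ.+-identityʳ a)))
    (cong (λ b → recipSum b l) (ℕ.+-comm a 1)))

  tail : ℕ → ℕ → ℚ
  tail p k = recipSum (suc k ℕ.+ p ℕ.* suc k) (suc p)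

  lnApprox-step : ∀ p k →
    recip (suc k) ℚ.+ lnApprox p (suc k) ≡ lnApprox p k ℚ.+ tail p k
  lnApprox-step p k = trans (sym (recipSum-head (suc k) (p ℕ.* suc (suc k))))
    (trans (cong (recipSum (suc k)) (lemma p k))
           (recipSum-++ (suc k) (p ℕ.* suc k) (suc p)))
    where
    lemma : ∀ p k → 1 ℕ.+ p ℕ.* suc (suc k) ≡ p ℕ.* suc k ℕ.+ suc p
    lemma = ℕSolver.solve-∀

  tail-lower : ∀ p k → recip (suc k) ℚ.≤ tail p k
  tail-lower p k = subst (ℚ._≤ tail p k) (frac-cancel p (suc k))
    (recipSum-lower _ (suc p) _ (ℕ.≤-reflexive (lemma p k)))
    where
    lemma : ∀ p k → suc k ℕ.+ p ℕ.* suc k ℕ.+ suc p ≡ suc (p ℕ.+ suc k ℕ.* suc p)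
    lemma = ℕSolver.solve-∀

  tail-upper : ∀ p k → tail p k ℚ.≤ recip k
  tail-upper p k = subst (tail p k ℚ.≤_) (frac-cancel p k)
    (recipSum-upper _ (suc p) _
      (ℕ.≤-trans (ℕ.n≤1+n _) (ℕ.≤-reflexive (lemma p k))))
    where
    lemma : ∀ p k → suc (p ℕ.+ k ℕ.* suc p) ≡ suc k ℕ.+ p ℕ.* suc k
    lemma = ℕSolver.solve-∀

  lnApprox-incr : ∀ p k → lnApprox p k ℚ.≤ lnApprox p (suc k)
  lnApprox-incr p k = subst₂ ℚ._≤_
    (solve 2 (λ r s → :- r :+ (s :+ r) := s) refl (recip (suc k)) (lnApprox p k))
    (solve 2 (λ r s → :- r :+ (r :+ s) := s) refl (recip (suc k)) (lnApprox p (suc k)))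
    (ℚ.+-monoʳ-≤ (ℚ.- recip (suc k))
      (subst (lnApprox p k ℚ.+ recip (suc k) ℚ.≤_) (sym (lnApprox-step p k))
        (ℚ.+-monoʳ-≤ (lnApprox p k) (tail-lower p k))))

  upper : ℕ → ℕ → ℚ
  upper p k = lnApprox p k ℚ.+ recip k

  upper-decr : ∀ p k → upper p (suc k) ℚ.≤ upper p k
  upper-decr p k = subst (ℚ._≤ upper p k)
    (trans (sym (lnApprox-step p k)) (ℚ.+-comm (recip (suc k)) (lnApprox p (suc k))))
    (ℚ.+-monoʳ-≤ (lnApprox p k) (tail-upper p k))

  lnApprox-mono : ∀ p {k m} → k ℕ.≤′ m → lnApprox p k ℚ.≤ lnApprox p m
  lnApprox-mono p ℕ.≤′-refl       = ℚ.≤-refl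
  lnApprox-mono p (ℕ.≤′-step k≤m) = ℚ.≤-trans (lnApprox-mono p k≤m) (lnApprox-incr p _)

  upper-antitone : ∀ p {k m} → k ℕ.≤′ m → upper p m ℚ.≤ upper p k
  upper-antitone p ℕ.≤′-refl       = ℚ.≤-refl
  upper-antitone p (ℕ.≤′-step k≤m) = ℚ.≤-trans (upper-decr p _) (upper-antitone p k≤m)

  lnApprox≤upper : ∀ p m → lnApprox p m ℚ.≤ upper p m
  lnApprox≤upper p m = subst (ℚ._≤ upper p m) (ℚ.+-identityʳ (lnApprox p m))
    (ℚ.+-monoʳ-≤ (lnApprox p m)
      (ℚ.nonNegative⁻¹ (recip m) {{ℚ.normalize-nonNeg 1 (suc m)}}))

  archimedean : ∀ ε → 0ℚ ℚ.< ε → ∃ λ N → recip N ℚ.≤ ε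
  archimedean ε@(mkℚ (+ suc a)  d _) _   = d , ℚ.toℚᵘ-cancel-≤
    (ℚᵘ.≤-respˡ-≃ (ℚᵘ.≃-sym (ℚ.toℚᵘ-fromℚᵘ (mkℚᵘ (+ 1) d)))
      (ℚᵘ.*≤* (ℤ.*-monoʳ-≤-nonNeg (+ suc d) {+ 1} {+ suc a} (ℤ.+≤+ (ℕ.s≤s ℕ.z≤n)))))
  archimedean   (mkℚ (+ zero)   d _) 0<ε with ℚ.positive 0<ε
  ... | ()
  archimedean   (mkℚ (-[1+ _ ]) d _) 0<ε with ℚ.positive 0<ε
  ... | ()

  abstract
    lnApprox-cauchy : ∀ p → Cauchy (lnApprox p)
    lnApprox-cauchy p ε 0<ε with archimedean ε 0<ε
    ... | N , 1/N≤ε = N , λ m n N≤m N≤n →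
      dist-intro (lnApprox p m) (lnApprox p n) (close N≤m N≤n) (close N≤n N≤m)
      where
      close : ∀ {m n} → N ℕ.≤ m → N ℕ.≤ n → lnApprox p m ℚ.≤ lnApprox p n ℚ.+ ε
      close {m} {n} N≤m N≤n = ℚ.≤-trans (lnApprox≤upper p m)
        (ℚ.≤-trans (upper-antitone p (ℕ.≤⇒≤′ N≤m))
          (ℚ.+-mono-≤ (lnApprox-mono p (ℕ.≤⇒≤′ N≤n)) 1/N≤ε))

-- ln n = ∫₁ⁿ dx/x, as the limit of Riemann sums.
ln : (n : ℕ) → .{{NonZero n}} → ℝ
ln (suc p) = mkℝ (lnApprox p) (lnApprox-cauchy p)

Heights : ℕ → Set
Heights n = Vector ℝ n

∑ : ∀ {n} → Vector ℝ n → ℝ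
∑ = foldr _+_ 0ℝ

record Move {n : ℕ} (c : ℝ) (h : Heights n) : Set where
  field
    pour        : Vector ℝ n
    pour-nonNeg : ∀ i → 0ℝ ≤ pour i
    pour-total  : ∑ pour ≃ 1ℝ

  filled : Heights n
  filled i = h i + pour i

  field
    estimate       : Vector ℝ n
    estimate-lower : ∀ i → filled i ≤ estimate i
    estimate-upper : ∀ i → estimate i ≤ filled i + c

open Move public

removeFrom : ∀ {n} → Fin n → Heights n → Heights n
removeFrom i g = updateAt g i (λ x → (x - 1ℝ) ⊔ 0ℝ)

-- Transcripts of finitely many steps, indexed by the heights they lead to.
-- The player's selections are unconstrained here.
data History (n : ℕ) (c : ℝ) : Heights n → Set where
  start : History n c (λ _ → 0ℝ)
  step  : ∀ {h} → History n c h → (m : Move c h) (i : Fin n) →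
          History n c (removeFrom i (filled m))

-- An adaptive adversary chooses its move from the entire past.
Adversary : ℕ → ℝ → Set
Adversary n c = ∀ {h} → History n c h → Move c h

IsGreedyChoice : ∀ {n} → Vector ℝ n → Fin n → Set
IsGreedyChoice estimates i = ∀ j → estimates j ≤ estimates i

-- The histories that can arise when greedy plays against A. Any maximal
-- estimate may be selected, so every tie-breaking rule is covered.
data GreedyPlay {n c} (A : Adversary n c) : ∀ {h} → History n c h → Set where
  start : GreedyPlay A start
  step  : ∀ {h} {H : History n c h} {i} → GreedyPlay A H →
          IsGreedyChoice (estimate (A H)) i → GreedyPlay A (step H (A H) i)

-- The backlog is a supremum over all plays, which need not be a real number
-- a priori; being at most b means that b bounds every height reached, both
-- between steps and at the intermediate moments after the adversary's move.
GreedyBacklog≤ : ∀ {n c} → Adversary n c → ℝ → Set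
GreedyBacklog≤ A b = ∀ {h} {H : History _ _ h} → GreedyPlay A H →
  (∀ i → h i ≤ b) × (∀ i → filled (A H) i ≤ b)

{-# OPTIONS --safe #-}
-- Let S be a set of k cups. After every step the water in S is at most
-- (c + 1) · k · (1 + 1/(k+1) + ⋯ + 1/n), and k = 1 gives the theorem since
-- 1/2 + ⋯ + 1/n ≤ ln n. Pouring adds at most 1 to S. Suppose greedy then
-- selects i; every filled cup exceeds the filled cup i by at most c. If i ∉ S,
-- the average of S is at most that of S ∪ {i} plus c/(k+1), and the bound for
-- S ∪ {i} before the step applies. If i ∈ S, either a full unit leaves S, or i
-- becomes empty and the previous case bounds the remaining k - 1 cups.
module Submission where

open import Defs
open import Data.Fin.Base using (Fin; zero; suc)
open import Data.Fin.Subset using (Subset; inside; outside; ⊥; ∣_∣; ∁; ⁅_⁆)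
open import Data.Fin.Subset.Properties using (∣⁅x⁆∣≡1; ∣∁p∣≡n∸∣p∣)
open import Data.Integer.Base as ℤ using (+_)
import Data.Integer.Properties as ℤ
import Data.Integer.Tactic.RingSolver as ℤSolver
open import Data.Nat.Base as ℕ using (ℕ; zero; suc; NonZero)
import Data.Nat.Properties as ℕ
import Data.Nat.Tactic.RingSolver as ℕSolver
open import Data.Product.Base using (∃; _,_; proj₁)
open import Data.Rational.Base as ℚ using (ℚ; 0ℚ; 1ℚ; ½)
import Data.Rational.Properties as ℚ
open import Data.Rational.Solver using (module +-*-Solver)
open import Data.Rational.Unnormalised.Base as ℚᵘ using (mkℚᵘ)
import Data.Rational.Unnormalised.Properties as ℚᵘ
open import Data.Vec.Base using ([]; _∷_; lookup; _[_]≔_)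
open import Data.Vec.Properties
  using (lookup∘updateAt; []≔-idempotent; []≔-lookup)
open import Data.Vec.Functional using (Vector)
open import Function.Base using (_∘_)
open import Level using (0ℓ)
open import Relation.Binary.Bundles using (Preorder)
open import Relation.Binary.PropositionalEquality
  using (_≡_; refl; sym; trans; cong; cong₂; subst; subst₂)

open +-*-Solver using (solve; _:=_; _:+_; _:*_; _:-_; con)

-- Order and arithmetic of the reals

infix 4 _≐_

-- Finer than `_≃_`: it turns ring identities between reals into termwise rational ones, which the
-- solver proves. Being a record, it lets `x` and `y` be inferred.
record _≐_ (x y : ℝ) : Set where
  constructor mk≐
  field
    pointwise : ∀ n → seq x n ≡ seq y n

≐-refl : ∀ {x} → x ≐ x
≐-refl = mk≐ λ _ → refl

≐-sym : ∀ {x y} → x ≐ y → y ≐ x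
≐-sym (mk≐ e) = mk≐ λ n → sym (e n)

≐-trans : ∀ {x y z} → x ≐ y → y ≐ z → x ≐ z
≐-trans (mk≐ e) (mk≐ e′) = mk≐ λ n → trans (e n) (e′ n)

pointwise⇒≤ : ∀ {x y} → (∀ n → seq x n ℚ.≤ seq y n) → x ≤ y
pointwise⇒≤ {x} {y} h = mk≤ λ ε 0<ε → 0 , λ n _ →
  ℚ.≤-trans (h n) (subst (ℚ._≤ seq y n ℚ.+ ε) (ℚ.+-identityʳ (seq y n))
    (ℚ.+-monoʳ-≤ (seq y n) (ℚ.<⇒≤ 0<ε)))

≐⇒≤ : ∀ {x y} → x ≐ y → x ≤ y
≐⇒≤ (mk≐ e) = pointwise⇒≤ λ n → ℚ.≤-reflexive (e n)

≤-refl : ∀ {x} → x ≤ x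
≤-refl = ≐⇒≤ ≐-refl

private
  0<½*_ : ∀ {ε} → 0ℚ ℚ.< ε → 0ℚ ℚ.< ½ ℚ.* ε
  0<½*_ {ε} 0<ε = subst (ℚ._< ½ ℚ.* ε) (ℚ.*-zeroʳ ½) (ℚ.*-monoʳ-<-pos ½ 0<ε)

  eventually-∧ : ∀ {P Q R : ℕ → Set} → (∀ n → P n → Q n → R n) →
                 Eventually P → Eventually Q → Eventually R
  eventually-∧ f (M , p) (N , q) = M ℕ.⊔ N , λ n n≥ →
    f n (p n (ℕ.m⊔n≤o⇒m≤o M N n≥)) (q n (ℕ.m⊔n≤o⇒n≤o M N n≥))

  eventually-map : ∀ {P Q : ℕ → Set} → (∀ n → P n → Q n) →
                   Eventually P → Eventually Q
  eventually-map f (N , p) = N , λ n n≥ → f n (p n n≥)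

≤-trans : ∀ {x y z} → x ≤ y → y ≤ z → x ≤ z
≤-trans {x} {y} {z} (mk≤ h) (mk≤ k) = mk≤ λ ε 0<ε →
  eventually-∧
    (λ n x≤y y≤z → ℚ.≤-trans x≤y (ℚ.≤-trans (ℚ.+-monoˡ-≤ (½ ℚ.* ε) y≤z)
      (ℚ.≤-reflexive (solve 2 (λ z e → z :+ con ½ :* e :+ con ½ :* e := z :+ e)
        refl (seq z n) ε))))
    (h (½ ℚ.* ε) (0<½* 0<ε)) (k (½ ℚ.* ε) (0<½* 0<ε))

-- Not a partial order: with `_≐_` as the equality, antisymmetry fails.
≤-preorder : Preorder 0ℓ 0ℓ 0ℓ
≤-preorder = record
  { Carrier = ℝ ; _≈_ = _≐_ ; _≲_ = _≤_
  ; isPreorder = record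
    { isEquivalence = record { refl = ≐-refl ; sym = ≐-sym ; trans = ≐-trans }
    ; reflexive = ≐⇒≤
    ; trans = ≤-trans
    }
  }

open import Relation.Binary.Reasoning.Preorder ≤-preorder

+-mono-≤ : ∀ {x y z w} → x ≤ y → z ≤ w → x + z ≤ y + w
+-mono-≤ {x} {y} {z} {w} (mk≤ h) (mk≤ k) = mk≤ λ ε 0<ε →
  eventually-∧
    (λ n x≤y z≤w → ℚ.≤-trans (ℚ.+-mono-≤ x≤y z≤w)
      (ℚ.≤-reflexive (solve 3
        (λ y w e → y :+ con ½ :* e :+ (w :+ con ½ :* e) := y :+ w :+ e)
        refl (seq y n) (seq w n) ε)))
    (h (½ ℚ.* ε) (0<½* 0<ε)) (k (½ ℚ.* ε) (0<½* 0<ε))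

+-cong : ∀ {x y z w} → x ≐ y → z ≐ w → x + z ≐ y + w
+-cong (mk≐ e) (mk≐ e′) = mk≐ λ n → cong₂ ℚ._+_ (e n) (e′ n)

⊔-lub : ∀ {x y z} → x ≤ z → y ≤ z → x ⊔ y ≤ z
⊔-lub (mk≤ h) (mk≤ k) = mk≤ λ ε 0<ε →
  eventually-∧ (λ _ x≤z y≤z → ℚ.⊔-lub x≤z y≤z) (h ε 0<ε) (k ε 0<ε)

x≤y+z⇒x-z≤y : ∀ {x y z} → x ≤ y + z → x - z ≤ y
x≤y+z⇒x-z≤y {x} {y} {z} h = begin
  x - z        ≲⟨ +-mono-≤ h (≤-refl {x = - z}) ⟩
  (y + z) - z  ≈⟨ mk≐ (λ n → solve 2 (λ y z → y :+ z :- z := y) refl (seq y n) (seq z n)) ⟩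
  y            ∎

x≤y-z⇒x+z≤y : ∀ {x y z} → x ≤ y - z → x + z ≤ y
x≤y-z⇒x+z≤y {x} {y} {z} h = begin
  x + z        ≲⟨ +-mono-≤ h ≤-refl ⟩
  (y - z) + z  ≈⟨ mk≐ (λ n → solve 2 (λ y z → y :- z :+ z := y) refl (seq y n) (seq z n)) ⟩
  y            ∎

-- Since `r ≤ 1`, the error `r * ε` is again at most `ε`, so no rescaling of `ε` is required. The
-- multipliers to come are k/(k+1) and 1/(k+1).
fromℚ-*-monoʳ-≤ : ∀ r → 0ℚ ℚ.≤ r → r ℚ.≤ 1ℚ → ∀ {x y} → x ≤ y → fromℚ r * x ≤ fromℚ r * y
fromℚ-*-monoʳ-≤ r 0≤r r≤1 {x} {y} (mk≤ h) = mk≤ λ ε 0<ε →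
  eventually-map
    (λ n x≤y → ℚ.≤-trans (ℚ.*-monoˡ-≤-nonNeg r {{ℚ.nonNegative 0≤r}} x≤y)
      (ℚ.≤-trans (ℚ.≤-reflexive (ℚ.*-distribˡ-+ r (seq y n) ε))
        (ℚ.+-monoʳ-≤ (r ℚ.* seq y n)
          (subst (r ℚ.* ε ℚ.≤_) (ℚ.*-identityˡ ε)
            (ℚ.*-monoʳ-≤-nonNeg ε {{ℚ.nonNegative (ℚ.<⇒≤ 0<ε)}} r≤1)))))
    (h ε 0<ε)

-- The terms of `x` are eventually above a positive gap, so the termwise inequality can be
-- multiplied by them without an upper bound on `x`.
*-monoʳ-pointwise : ∀ {x y z} → 0ℝ < x → (∀ n → seq y n ℚ.≤ seq z n) → x * y ≤ x * z
*-monoʳ-pointwise {x} {y} {z} (mk< g 0<g pos) h = mk≤ λ ε 0<ε →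
  eventually-map
    (λ n g≤x → ℚ.≤-trans
      (ℚ.*-monoˡ-≤-nonNeg (seq x n)
        {{ℚ.nonNegative (ℚ.≤-trans (ℚ.<⇒≤ 0<g)
          (subst (ℚ._≤ seq x n) (ℚ.+-identityˡ g) g≤x))}} (h n))
      (subst (ℚ._≤ seq x n ℚ.* seq z n ℚ.+ ε) (ℚ.+-identityʳ (seq x n ℚ.* seq z n))
        (ℚ.+-monoʳ-≤ (seq x n ℚ.* seq z n) (ℚ.<⇒≤ 0<ε))))
    pos

<⇒≤ : ∀ {x y} → x < y → x ≤ y
<⇒≤ {x} {y} (mk< g 0<g h) = mk≤ λ ε 0<ε →
  eventually-map
    (λ n x+g≤y → ℚ.≤-trans
      (subst (ℚ._≤ seq x n ℚ.+ g) (ℚ.+-identityʳ (seq x n))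
        (ℚ.+-monoʳ-≤ (seq x n) (ℚ.<⇒≤ 0<g)))
      (ℚ.≤-trans x+g≤y (subst (ℚ._≤ seq y n ℚ.+ ε) (ℚ.+-identityʳ (seq y n))
        (ℚ.+-monoʳ-≤ (seq y n) (ℚ.<⇒≤ 0<ε)))))
    h

0<x⇒0<x+1 : ∀ {x} → 0ℝ < x → 0ℝ < x + 1ℝ
0<x⇒0<x+1 {x} (mk< g 0<g h) = mk< g 0<g
  (eventually-map
    (λ n g≤x → ℚ.≤-trans g≤x (subst (ℚ._≤ seq x n ℚ.+ 1ℚ) (ℚ.+-identityʳ (seq x n))
      (ℚ.+-monoʳ-≤ (seq x n) (ℚ.nonNegative⁻¹ 1ℚ))))
    h)

-- Harmonic sums

fromℕ : ℕ → ℚ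
fromℕ k = + k ℚ./ 1

recip : ℕ → ℚ
recip d = + 1 ℚ./ suc d

0≤fromℕ : ∀ k → 0ℚ ℚ.≤ fromℕ k
0≤fromℕ k = ℚ.nonNegative⁻¹ (fromℕ k) {{ℚ.normalize-nonNeg k 1}}

0≤recip : ∀ d → 0ℚ ℚ.≤ recip d
0≤recip d = ℚ.nonNegative⁻¹ (recip d) {{ℚ.normalize-nonNeg 1 (suc d)}}

fromℕ-suc : ∀ k → fromℕ (suc k) ≡ 1ℚ ℚ.+ fromℕ k
fromℕ-suc k = ℚ.toℚᵘ-injective
  (ℚᵘ.≃-trans (ℚ.toℚᵘ-fromℚᵘ (mkℚᵘ (+ suc k) 0))
  (ℚᵘ.≃-trans (ℚᵘ.*≡* (lemma (+ k)))
  (ℚᵘ.≃-trans (ℚᵘ.+-congʳ (ℚ.toℚᵘ 1ℚ) (ℚᵘ.≃-sym (ℚ.toℚᵘ-fromℚᵘ (mkℚᵘ (+ k) 0))))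
              (ℚᵘ.≃-sym (ℚ.toℚᵘ-homo-+ 1ℚ (fromℕ k))))))
  where
  lemma : ∀ x → (+ 1 ℤ.+ x) ℤ.* + 1 ≡ (+ 1 ℤ.* + 1 ℤ.+ x ℤ.* + 1) ℤ.* + 1
  lemma = ℤSolver.solve-∀

fromℕ-*-recip : ∀ m d e → suc e ≡ suc m ℕ.* suc d → fromℕ (suc m) ℚ.* recip e ≡ recip d
fromℕ-*-recip m d e eq = ℚ.toℚᵘ-injective
  (ℚᵘ.≃-trans (ℚ.toℚᵘ-homo-* (fromℕ (suc m)) (recip e))
  (ℚᵘ.≃-trans (ℚᵘ.*-cong (ℚ.toℚᵘ-fromℚᵘ (mkℚᵘ (+ suc m) 0)) (ℚ.toℚᵘ-fromℚᵘ (mkℚᵘ (+ 1) e)))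
  (ℚᵘ.≃-trans (ℚᵘ.*≡* (cong +_ lemma))
              (ℚᵘ.≃-sym (ℚ.toℚᵘ-fromℚᵘ (mkℚᵘ (+ 1) d))))))
  where
  lemma : suc m ℕ.* 1 ℕ.* suc d ≡ 1 ℕ.* (1 ℕ.* suc e)
  lemma = trans (cong (ℕ._* suc d) (ℕ.*-identityʳ (suc m)))
    (trans (sym eq) (sym (trans (ℕ.*-identityˡ (1 ℕ.* suc e)) (ℕ.*-identityˡ (suc e)))))

recip-antitone : ∀ {d e} → d ℕ.≤ e → recip e ℚ.≤ recip d
recip-antitone {d} {e} d≤e = ℚ.toℚᵘ-cancel-≤
  (ℚᵘ.≤-respˡ-≃ (ℚᵘ.≃-sym (ℚ.toℚᵘ-fromℚᵘ (mkℚᵘ (+ 1) e)))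
    (ℚᵘ.≤-respʳ-≃ (ℚᵘ.≃-sym (ℚ.toℚᵘ-fromℚᵘ (mkℚᵘ (+ 1) d)))
      (ℚᵘ.*≤* (ℤ.*-monoˡ-≤-nonNeg (+ 1) (ℤ.+≤+ (ℕ.s≤s d≤e))))))

0≤recipSum : ∀ a l → 0ℚ ℚ.≤ recipSum a l
0≤recipSum a zero    = ℚ.≤-refl
0≤recipSum a (suc l) = ℚ.+-mono-≤ (0≤recipSum a l) (0≤recip (a ℕ.+ l))

recipSum-++ : ∀ a l q → recipSum a (l ℕ.+ q) ≡ recipSum a l ℚ.+ recipSum (a ℕ.+ l) q
recipSum-++ a l zero    = trans (cong (recipSum a) (ℕ.+-identityʳ l))
                                (sym (ℚ.+-identityʳ (recipSum a l)))
recipSum-++ a l (suc q) = trans (cong (recipSum a) (ℕ.+-suc l q))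
  (trans (cong₂ ℚ._+_ (recipSum-++ a l q) (cong recip (sym (ℕ.+-assoc a l q))))
         (ℚ.+-assoc (recipSum a l) (recipSum (a ℕ.+ l) q) (recip (a ℕ.+ l ℕ.+ q))))

recipSum-head : ∀ a l → recipSum a (suc l) ≡ recip a ℚ.+ recipSum (suc a) l
recipSum-head a l = trans (recipSum-++ a 1 l) (cong₂ ℚ._+_
  (trans (ℚ.+-identityˡ (recip (a ℕ.+ 0))) (cong recip (ℕ.+-identityʳ a)))
  (cong (λ b → recipSum b l) (ℕ.+-comm a 1)))

-- Every denominator in the sum is at most `b + l`, so each of the `l` terms is at least `recip e`.
recipSum-lower : ∀ b l e → b ℕ.+ l ℕ.≤ suc e → fromℕ l ℚ.* recip e ℚ.≤ recipSum b l
recipSum-lower b zero    e h = ℚ.≤-reflexive (ℚ.*-zeroˡ (recip e))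
recipSum-lower b (suc l) e h = subst (ℚ._≤ recipSum b (suc l))
  (sym (trans (cong (ℚ._* recip e) (fromℕ-suc l))
    (solve 2 (λ k u → (con 1ℚ :+ k) :* u := k :* u :+ u) refl (fromℕ l) (recip e))))
  (ℚ.+-mono-≤ (recipSum-lower b l e (ℕ.≤-trans (ℕ.n≤1+n (b ℕ.+ l)) h′))
              (recip-antitone (ℕ.s≤s⁻¹ h′)))
  where
  h′ : suc (b ℕ.+ l) ℕ.≤ suc e
  h′ = subst (ℕ._≤ suc e) (ℕ.+-suc b l) h

-- 1/2 + ⋯ + 1/(p+1) is the Riemann sum of mesh 1; refining the mesh replaces
-- each 1/(j+1) by k + 1 terms that are at least 1/((k+1)(j+1)).
recipSum≤lnApprox : ∀ p k → recipSum 1 p ℚ.≤ lnApprox p k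
recipSum≤lnApprox zero    k = ℚ.≤-refl
recipSum≤lnApprox (suc p) k = subst (recipSum 1 (suc p) ℚ.≤_)
  (sym (trans (cong (recipSum (suc k)) (ℕ.+-comm (suc k) (p ℕ.* suc k)))
              (recipSum-++ (suc k) (p ℕ.* suc k) (suc k))))
  (ℚ.+-mono-≤ (recipSum≤lnApprox p k)
    (subst (ℚ._≤ recipSum (suc k ℕ.+ p ℕ.* suc k) (suc k))
      (fromℕ-*-recip k (suc p) _ (eq₁ p k))
      (recipSum-lower _ (suc k) _ (ℕ.≤-reflexive (eq₂ p k)))))
  where
  eq₁ : ∀ p k → suc (k ℕ.+ suc p ℕ.* suc k) ≡ suc k ℕ.* suc (suc p)
  eq₁ = ℕSolver.solve-∀
  eq₂ : ∀ p k → suc k ℕ.+ p ℕ.* suc k ℕ.+ suc k ≡ suc (k ℕ.+ suc p ℕ.* suc k)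
  eq₂ = ℕSolver.solve-∀

-- level k l bounds the water in k of k + l cups, in units of c + 1.
level : ℕ → ℕ → ℚ
level k l = fromℕ k ℚ.* (1ℚ ℚ.+ recipSum k l)

0≤level : ∀ k l → 0ℚ ℚ.≤ level k l
0≤level k l = subst (ℚ._≤ level k l) (ℚ.*-zeroʳ (fromℕ k))
  (ℚ.*-monoˡ-≤-nonNeg (fromℕ k) {{ℚ.nonNegative (0≤fromℕ k)}}
    (ℚ.+-mono-≤ (ℚ.nonNegative⁻¹ 1ℚ) (0≤recipSum k l)))

k/[1+k] : ℕ → ℚ
k/[1+k] k = fromℕ k ℚ.* recip k

-- These are the convex weights with which `filled-bounded-∌` splits the water of a set of `k` cups.
k/[1+k]+recip≡1 : ∀ k → k/[1+k] k ℚ.+ recip k ≡ 1ℚ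
k/[1+k]+recip≡1 k = trans
  (solve 2 (λ k u → k :* u :+ u := (con 1ℚ :+ k) :* u) refl (fromℕ k) (recip k))
  (trans (cong (ℚ._* recip k) (sym (fromℕ-suc k)))
         (fromℕ-*-recip k 0 k (sym (ℕ.*-identityʳ (suc k)))))

0≤k/[1+k] : ∀ k → 0ℚ ℚ.≤ k/[1+k] k
0≤k/[1+k] k = subst (ℚ._≤ k/[1+k] k) (ℚ.*-zeroʳ (fromℕ k))
  (ℚ.*-monoˡ-≤-nonNeg (fromℕ k) {{ℚ.nonNegative (0≤fromℕ k)}} (0≤recip k))

k/[1+k]≤1 : ∀ k → k/[1+k] k ℚ.≤ 1ℚ
k/[1+k]≤1 k = subst₂ ℚ._≤_ (ℚ.+-identityʳ (k/[1+k] k)) (k/[1+k]+recip≡1 k)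
  (ℚ.+-monoʳ-≤ (k/[1+k] k) (0≤recip k))

recip≤1 : ∀ k → recip k ℚ.≤ 1ℚ
recip≤1 k = recip-antitone {0} {k} ℕ.z≤n

-- The factor k/(k+1) cancels the k + 1 in `level (suc k) l` and turns the added unit into k ·
-- `recip k`; this `recip k` is the new leading term of the harmonic sum.
level-rec : ∀ k l → k/[1+k] k ℚ.* (level (suc k) l ℚ.+ 1ℚ) ≡ level k (suc l)
level-rec k l = trans
  (cong (λ m → k/[1+k] k ℚ.* (m ℚ.* (1ℚ ℚ.+ H) ℚ.+ 1ℚ)) (fromℕ-suc k))
  (trans (solve 3 (λ k u h →
      k :* u :* ((con 1ℚ :+ k) :* (con 1ℚ :+ h) :+ con 1ℚ) :=
      k :* ((k :* u :+ u) :* (con 1ℚ :+ h) :+ u)) refl (fromℕ k) (recip k) H)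
  (trans (cong (λ o → fromℕ k ℚ.* (o ℚ.* (1ℚ ℚ.+ H) ℚ.+ recip k)) (k/[1+k]+recip≡1 k))
  (trans (solve 3 (λ k u h →
      k :* (con 1ℚ :* (con 1ℚ :+ h) :+ u) := k :* (con 1ℚ :+ (u :+ h)))
      refl (fromℕ k) (recip k) H)
  (cong (λ h → fromℕ k ℚ.* (1ℚ ℚ.+ h)) (sym (recipSum-head k l))))))
  where
  H : ℚ
  H = recipSum (suc k) l

-- With H = `recipSum (suc k) l`, the difference of the two sides is 1 + H - k/(k+1), which is
-- nonnegative.
level-incr : ∀ k l → level k (suc l) ℚ.≤ level (suc k) l
level-incr k l = subst₂ ℚ._≤_
  (trans (solve 3 (λ k u h →
      k :* (con 1ℚ :+ h) :+ (k :* u :+ con 0ℚ) := k :* (con 1ℚ :+ (u :+ h)))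
      refl (fromℕ k) (recip k) H)
    (cong (λ h → fromℕ k ℚ.* (1ℚ ℚ.+ h)) (sym (recipSum-head k l))))
  (trans (solve 2 (λ k h →
      k :* (con 1ℚ :+ h) :+ (con 1ℚ :+ h) := (con 1ℚ :+ k) :* (con 1ℚ :+ h))
      refl (fromℕ k) H)
    (cong (ℚ._* (1ℚ ℚ.+ H)) (sym (fromℕ-suc k))))
  (ℚ.+-monoʳ-≤ (fromℕ k ℚ.* (1ℚ ℚ.+ H))
    (ℚ.+-mono-≤ (k/[1+k]≤1 k) (0≤recipSum (suc k) l)))
  where
  H : ℚ
  H = recipSum (suc k) l

-- Water in a set of cups

∑[_] : ∀ {n} → Subset n → Vector ℝ n → ℝ
∑[ [] ]          f = 0ℝ
∑[ inside  ∷ S ] f = f zero + ∑[ S ] (f ∘ suc)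
∑[ outside ∷ S ] f = ∑[ S ] (f ∘ suc)

∑[]-mono : ∀ {n} (S : Subset n) {f g : Vector ℝ n} → (∀ j → f j ≤ g j) → ∑[ S ] f ≤ ∑[ S ] g
∑[]-mono []            h = ≤-refl
∑[]-mono (inside  ∷ S) h = +-mono-≤ (h zero) (∑[]-mono S (h ∘ suc))
∑[]-mono (outside ∷ S) h = ∑[]-mono S (h ∘ suc)

∑[]-+ : ∀ {n} (S : Subset n) (f g : Vector ℝ n) → ∑[ S ] (λ j → f j + g j) ≐ ∑[ S ] f + ∑[ S ] g
∑[]-+ []            f g = mk≐ λ _ → refl
∑[]-+ (inside  ∷ S) f g = ≐-trans (+-cong ≐-refl (∑[]-+ S (f ∘ suc) (g ∘ suc)))
  (mk≐ λ n → solve 4 (λ a b c d → a :+ b :+ (c :+ d) := a :+ c :+ (b :+ d)) refl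
    (seq (f zero) n) (seq (g zero) n) (seq (∑[ S ] (f ∘ suc)) n) (seq (∑[ S ] (g ∘ suc)) n))
∑[]-+ (outside ∷ S) f g = ∑[]-+ S (f ∘ suc) (g ∘ suc)

∑[]-const : ∀ {n} (S : Subset n) x → ∑[ S ] (λ _ → x) ≐ fromℚ (fromℕ ∣ S ∣) * x
∑[]-const []            x = mk≐ λ n → sym (ℚ.*-zeroˡ (seq x n))
∑[]-const (inside  ∷ S) x = ≐-trans (+-cong ≐-refl (∑[]-const S x)) (mk≐ λ n → trans
  (solve 2 (λ k x → x :+ k :* x := (con 1ℚ :+ k) :* x) refl (fromℕ ∣ S ∣) (seq x n))
  (cong (ℚ._* seq x n) (sym (fromℕ-suc ∣ S ∣))))
∑[]-const (outside ∷ S) x = ∑[]-const S x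

∑[]≤∑ : ∀ {n} (S : Subset n) {f : Vector ℝ n} → (∀ j → 0ℝ ≤ f j) → ∑[ S ] f ≤ ∑ f
∑[]≤∑ []            0≤f = ≤-refl
∑[]≤∑ (inside  ∷ S) 0≤f = +-mono-≤ ≤-refl (∑[]≤∑ S (0≤f ∘ suc))
∑[]≤∑ (outside ∷ S) {f} 0≤f = begin
  ∑[ S ] (f ∘ suc)         ≈⟨ mk≐ (λ n → sym (ℚ.+-identityˡ (seq (∑[ S ] (f ∘ suc)) n))) ⟩
  0ℝ + ∑[ S ] (f ∘ suc)    ≲⟨ +-mono-≤ (0≤f zero) (∑[]≤∑ S (0≤f ∘ suc)) ⟩
  f zero + ∑ (f ∘ suc)     ∎

∑[]-⁅⁆ : ∀ {n} (i : Fin n) (f : Vector ℝ n) → ∑[ ⁅ i ⁆ ] f ≐ f i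
∑[]-⁅⁆ zero    f = ≐-trans (+-cong ≐-refl (∑[]-⊥ (f ∘ suc)))
  (mk≐ λ n → ℚ.+-identityʳ (seq (f zero) n))
  where
  ∑[]-⊥ : ∀ {n} (f : Vector ℝ n) → ∑[ ⊥ ] f ≐ 0ℝ
  ∑[]-⊥ {zero}  f = ≐-refl
  ∑[]-⊥ {suc n} f = ∑[]-⊥ (f ∘ suc)
∑[]-⁅⁆ (suc i) f = ∑[]-⁅⁆ i (f ∘ suc)

-- Sets containing `i` are always presented as a set missing `i` with `i` added, so both sets are at
-- hand.
∑[]-insert : ∀ {n} (S : Subset n) i (f : Vector ℝ n) → lookup S i ≡ outside →
             ∑[ S [ i ]≔ inside ] f ≐ ∑[ S ] f + f i
∑[]-insert (outside ∷ S) zero f _ =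
  mk≐ λ n → ℚ.+-comm (seq (f zero) n) (seq (∑[ S ] (f ∘ suc)) n)
∑[]-insert (inside ∷ S) (suc i) f i∉S =
  ≐-trans (+-cong ≐-refl (∑[]-insert S i (f ∘ suc) i∉S))
    (mk≐ λ n → sym (ℚ.+-assoc (seq (f zero) n) (seq (∑[ S ] (f ∘ suc)) n) (seq (f (suc i)) n)))
∑[]-insert (outside ∷ S) (suc i) f i∉S = ∑[]-insert S i (f ∘ suc) i∉S

∣insert∣ : ∀ {n} (S : Subset n) i → lookup S i ≡ outside → ∣ S [ i ]≔ inside ∣ ≡ suc ∣ S ∣
∣insert∣ (outside ∷ S) zero    _   = refl
∣insert∣ (inside  ∷ S) (suc i) i∉S = cong suc (∣insert∣ S i i∉S)
∣insert∣ (outside ∷ S) (suc i) i∉S = ∣insert∣ S i i∉S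

∣∁insert∣ : ∀ {n} (S : Subset n) i → lookup S i ≡ outside →
            ∣ ∁ S ∣ ≡ suc ∣ ∁ (S [ i ]≔ inside) ∣
∣∁insert∣ (outside ∷ S) zero    _   = refl
∣∁insert∣ (inside  ∷ S) (suc i) i∉S = ∣∁insert∣ S i i∉S
∣∁insert∣ (outside ∷ S) (suc i) i∉S = cong suc (∣∁insert∣ S i i∉S)

∑[]-removeFrom : ∀ {n} (S : Subset n) i (g : Heights n) → lookup S i ≡ outside →
                 ∑[ S ] (removeFrom i g) ≐ ∑[ S ] g
∑[]-removeFrom (outside ∷ S) zero    g _   = ≐-refl
∑[]-removeFrom (inside  ∷ S) (suc i) g i∉S = +-cong ≐-refl (∑[]-removeFrom S i (g ∘ suc) i∉S)
∑[]-removeFrom (outside ∷ S) (suc i) g i∉S = ∑[]-removeFrom S i (g ∘ suc) i∉S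

removeFrom-selected : ∀ {n} i (g : Heights n) → removeFrom i g i ≡ (g i - 1ℝ) ⊔ 0ℝ
removeFrom-selected zero    g = refl
removeFrom-selected (suc i) g = removeFrom-selected i (g ∘ suc)

-- The invariant and its recurrence

bound : ∀ {n} → ℝ → Subset n → ℝ
bound c S = (c + 1ℝ) * fromℚ (level ∣ S ∣ ∣ ∁ S ∣)

-- All sets are bounded at once because the step for `S` consults a set with one more cup.
Bounded : ∀ {n} → ℝ → Heights n → Set
Bounded c h = ∀ S → ∑[ S ] h ≤ bound c S

-- This is `level-rec` scaled by `c + 1`: the poured unit and the error `c` together make exactly
-- one `c + 1`. Counting the outside cups by `∁` makes the insertion trade one outside cup for one
-- inside, without subtraction.
bound-insert : ∀ {n} c (S : Subset n) i → lookup S i ≡ outside →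
               fromℚ (k/[1+k] ∣ S ∣) * (bound c (S [ i ]≔ inside) + 1ℝ + c) ≐ bound c S
bound-insert c S i i∉S rewrite ∣insert∣ S i i∉S | ∣∁insert∣ S i i∉S = mk≐ λ n → trans
  (solve 3 (λ r c q → r :* ((c :+ con 1ℚ) :* q :+ con 1ℚ :+ c) :=
                      (c :+ con 1ℚ) :* (r :* (q :+ con 1ℚ)))
    refl (k/[1+k] ∣ S ∣) (seq c n) (level (suc ∣ S ∣) l))
  (cong ((seq c n ℚ.+ 1ℚ) ℚ.*_) (level-rec ∣ S ∣ l))
  where
  l : ℕ
  l = ∣ ∁ (S [ i ]≔ inside) ∣

bound-incr : ∀ {n} c → 0ℝ < c → (S : Subset n) → ∀ i → lookup S i ≡ outside →
             bound c S ≤ bound c (S [ i ]≔ inside)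
bound-incr c 0<c S i i∉S rewrite ∣insert∣ S i i∉S | ∣∁insert∣ S i i∉S =
  *-monoʳ-pointwise (0<x⇒0<x+1 0<c) λ _ → level-incr ∣ S ∣ ∣ ∁ (S [ i ]≔ inside) ∣

-- One step of the game

module _ {n : ℕ} (c : ℝ) (0<c : 0ℝ < c) {h : Heights n} (bounded : Bounded c h) (m : Move c h) where

  filled-bounded : ∀ S → ∑[ S ] (filled m) ≤ bound c S + 1ℝ
  filled-bounded S = begin
    ∑[ S ] (filled m)           ≈⟨ ∑[]-+ S h (pour m) ⟩
    ∑[ S ] h + ∑[ S ] (pour m)  ≲⟨ +-mono-≤ (bounded S)
                                     (≤-trans (∑[]≤∑ S (pour-nonNeg m)) (proj₁ (pour-total m))) ⟩
    bound c S + 1ℝ              ∎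

  module _ (i : Fin n) (greedy : IsGreedyChoice (estimate m) i) where

    -- The heights are compared through the estimates: that of `j` is at least its height, at most
    -- that of `i`, and so at most the height of `i` plus `c`.
    filled≤selected+c : ∀ j → filled m j ≤ filled m i + c
    filled≤selected+c j = ≤-trans (estimate-lower m j) (≤-trans (greedy j) (estimate-upper m i))

    -- With weights r = k/(k+1) and u = 1/(k+1), s = r s + u s. Comparing only the second share with
    -- cup `i` gives s ≤ r (s + gᵢ + c), where s + gᵢ is the water in the enlarged set. No division
    -- by k occurs, so the empty set is covered.
    filled-bounded-∌ : ∀ S → lookup S i ≡ outside → ∑[ S ] (filled m) ≤ bound c S
    filled-bounded-∌ S i∉S = begin
      s
        ≈⟨ mk≐ (λ n → trans (sym (ℚ.*-identityˡ (seq s n)))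
             (trans (cong (ℚ._* seq s n) (sym (k/[1+k]+recip≡1 ∣ S ∣)))
                    (ℚ.*-distribʳ-+ (seq s n) r u))) ⟩
      fromℚ r * s + fromℚ u * s
        -- Each of the k cups holds at most gᵢ + c; the next line absorbs u · k into r.
        ≲⟨ +-mono-≤ ≤-refl (fromℚ-*-monoʳ-≤ u (0≤recip ∣ S ∣) (recip≤1 ∣ S ∣)
             (≤-trans (∑[]-mono S filled≤selected+c) (≐⇒≤ (∑[]-const S (gᵢ + c))))) ⟩
      fromℚ r * s + fromℚ u * (fromℚ (fromℕ ∣ S ∣) * (gᵢ + c))
        ≈⟨ mk≐ (λ n → solve 5 (λ k u s g c →
             k :* u :* s :+ u :* (k :* (g :+ c)) := k :* u :* (s :+ g :+ c))
             refl (fromℕ ∣ S ∣) u (seq s n) (seq gᵢ n) (seq c n)) ⟩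
      fromℚ r * (s + gᵢ + c)
        ≲⟨ fromℚ-*-monoʳ-≤ r (0≤k/[1+k] ∣ S ∣) (k/[1+k]≤1 ∣ S ∣) (+-mono-≤
             (≤-trans (≐⇒≤ (≐-sym (∑[]-insert S i (filled m) i∉S)))
                      (filled-bounded (S [ i ]≔ inside)))
             ≤-refl) ⟩
      fromℚ r * (bound c (S [ i ]≔ inside) + 1ℝ + c)
        ≈⟨ bound-insert c S i i∉S ⟩
      bound c S ∎
      where
      s gᵢ : ℝ
      s  = ∑[ S ] (filled m)
      gᵢ = filled m i
      r u : ℚ
      r = k/[1+k] ∣ S ∣
      u = recip ∣ S ∣

    -- Both arguments of the maximum are bounded separately, so it need not be decided whether cup
    -- `i` held a full unit.
    removeFrom-bounded-∋ : ∀ S → lookup S i ≡ outside →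
      ∑[ S [ i ]≔ inside ] (removeFrom i (filled m)) ≤ bound c (S [ i ]≔ inside)
    removeFrom-bounded-∋ S i∉S = begin
      ∑[ S⁺ ] (removeFrom i (filled m))
        ≈⟨ ∑[]-insert S i (removeFrom i (filled m)) i∉S ⟩
      ∑[ S ] (removeFrom i (filled m)) + removeFrom i (filled m) i
        ≈⟨ +-cong (∑[]-removeFrom S i (filled m) i∉S)
             (mk≐ λ n → cong (λ x → seq x n) (removeFrom-selected i (filled m))) ⟩
      s + ((gᵢ - 1ℝ) ⊔ 0ℝ)
        ≈⟨ mk≐ (λ n → ℚ.+-comm (seq s n) (seq ((gᵢ - 1ℝ) ⊔ 0ℝ) n)) ⟩
      ((gᵢ - 1ℝ) ⊔ 0ℝ) + s
        ≲⟨ x≤y-z⇒x+z≤y (⊔-lub unit-removed emptied) ⟩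
      bound c S⁺ ∎
      where
      S⁺ : Subset n
      S⁺ = S [ i ]≔ inside
      s gᵢ : ℝ
      s  = ∑[ S ] (filled m)
      gᵢ = filled m i
      unit-removed : gᵢ - 1ℝ ≤ bound c S⁺ - s
      unit-removed = begin
        gᵢ - 1ℝ
          ≈⟨ mk≐ (λ n → solve 2 (λ g s → g :- con 1ℚ := s :+ g :- con 1ℚ :- s)
               refl (seq gᵢ n) (seq s n)) ⟩
        (s + gᵢ) - 1ℝ - s
          ≲⟨ +-mono-≤ (x≤y+z⇒x-z≤y (≤-trans (≐⇒≤ (≐-sym (∑[]-insert S i (filled m) i∉S)))
                                            (filled-bounded S⁺))) ≤-refl ⟩
        bound c S⁺ - s ∎
      -- Here only the water of `S` remains, and `S` avoids `i`; its smaller bound is then raised to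
      -- that of `S⁺`.
      emptied : 0ℝ ≤ bound c S⁺ - s
      emptied = begin
        0ℝ
          ≈⟨ mk≐ (λ n → sym (ℚ.+-inverseʳ (seq s n))) ⟩
        s - s
          ≲⟨ +-mono-≤ (≤-trans (filled-bounded-∌ S i∉S) (bound-incr c 0<c S i i∉S)) ≤-refl ⟩
        bound c S⁺ - s ∎

    removeFrom-bounded : Bounded c (removeFrom i (filled m))
    removeFrom-bounded S with lookup S i in eq
    ... | outside = ≤-trans (≐⇒≤ (∑[]-removeFrom S i (filled m) eq)) (filled-bounded-∌ S eq)
    -- Take `i` out of `S` to meet the hypothesis of `removeFrom-bounded-∋`, then put it back.
    ... | inside  = subst (λ T → ∑[ T ] (removeFrom i (filled m)) ≤ bound c T) reinsert
      (removeFrom-bounded-∋ (S [ i ]≔ outside) (lookup∘updateAt i S))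
      where
      reinsert : (S [ i ]≔ outside) [ i ]≔ inside ≡ S
      reinsert = trans ([]≔-idempotent S i)
        (trans (cong (S [ i ]≔_) (sym eq)) ([]≔-lookup S i))

-- Whole plays and the logarithmic bound

initially-bounded : ∀ {n} c → 0ℝ < c → Bounded {n} c (λ _ → 0ℝ)
initially-bounded c 0<c S = begin
  ∑[ S ] (λ _ → 0ℝ)            ≈⟨ ∑[]-const S 0ℝ ⟩
  -- Zero is rewritten as a multiple of `c + 1` so that nonnegativity of `level` suffices.
  fromℚ (fromℕ ∣ S ∣) * 0ℝ     ≈⟨ mk≐ (λ n → trans (ℚ.*-zeroʳ (fromℕ ∣ S ∣))
                                    (sym (ℚ.*-zeroʳ (seq c n ℚ.+ 1ℚ)))) ⟩
  (c + 1ℝ) * 0ℝ                ≲⟨ *-monoʳ-pointwise (0<x⇒0<x+1 0<c)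
                                    (λ _ → 0≤level ∣ S ∣ ∣ ∁ S ∣) ⟩
  bound c S                    ∎

greedy-bounded : ∀ {n c} → 0ℝ < c → {A : Adversary n c} →
                 ∀ {h} {H : History n c h} → GreedyPlay A H → Bounded c h
greedy-bounded {c = c} 0<c start = initially-bounded c 0<c
greedy-bounded {c = c} 0<c {A} (step {H = H} {i} play greedy) =
  removeFrom-bounded c 0<c (greedy-bounded 0<c play) (A H) i greedy

-- For one of p + 1 cups, `level 1 p` is 1 + 1/2 + ⋯ + 1/(p+1); all but the leading 1 is absorbed by
-- the logarithm.
bound-⁅⁆ : ∀ {p} c → 0ℝ < c → (i : Fin (suc p)) →
           bound c ⁅ i ⁆ + 1ℝ ≤ (c + 1ℝ) * ln (suc p) + (1ℝ + 1ℝ) * (c + 1ℝ)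
bound-⁅⁆ {p} c 0<c i rewrite ∣∁p∣≡n∸∣p∣ ⁅ i ⁆ | ∣⁅x⁆∣≡1 i = begin
  (c + 1ℝ) * fromℚ (level 1 p) + 1ℝ
    -- The harmonic sum is below the Riemann sum of every mesh, so the comparison holds at each
    -- index of the sequence.
    ≲⟨ +-mono-≤ (*-monoʳ-pointwise {z = 1ℝ + ln (suc p)} (0<x⇒0<x+1 0<c) λ n →
         ℚ.≤-trans (ℚ.≤-reflexive (ℚ.*-identityˡ (1ℚ ℚ.+ recipSum 1 p)))
                   (ℚ.+-monoʳ-≤ 1ℚ (recipSum≤lnApprox p n)))
         1≤c+1 ⟩
  (c + 1ℝ) * (1ℝ + ln (suc p)) + (c + 1ℝ)
    ≈⟨ mk≐ (λ n → solve 2 (λ c l →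
         (c :+ con 1ℚ) :* (con 1ℚ :+ l) :+ (c :+ con 1ℚ) :=
         (c :+ con 1ℚ) :* l :+ (con 1ℚ :+ con 1ℚ) :* (c :+ con 1ℚ))
         refl (seq c n) (lnApprox p n)) ⟩
  (c + 1ℝ) * ln (suc p) + (1ℝ + 1ℝ) * (c + 1ℝ) ∎
  where
  1≤c+1 : 1ℝ ≤ c + 1ℝ
  1≤c+1 = begin
    1ℝ       ≈⟨ mk≐ (λ _ → refl) ⟩
    0ℝ + 1ℝ  ≲⟨ +-mono-≤ (<⇒≤ 0<c) ≤-refl ⟩
    c + 1ℝ   ∎

theorem5 : ∃ λ (C : ℝ) →
    (c : ℝ) → 0ℝ < c →
    (n : ℕ) .{{_ : NonZero n}} →
    (A : Adversary n c) →
    GreedyBacklog≤ A ((c + 1ℝ) * ln n + C * (c + 1ℝ))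
-- The constant 2 counts one `c + 1` for the leading 1 of `level` and one for the unit just poured.
theorem5 = 1ℝ + 1ℝ , λ where
  c 0<c (suc p) A {h} {H} play →
    let filled≤ : ∀ i → filled (A H) i ≤ (c + 1ℝ) * ln (suc p) + (1ℝ + 1ℝ) * (c + 1ℝ)
        filled≤ i = begin
          filled (A H) i              ≈⟨ ≐-sym (∑[]-⁅⁆ i (filled (A H))) ⟩
          ∑[ ⁅ i ⁆ ] (filled (A H))   ≲⟨ filled-bounded c 0<c (greedy-bounded 0<c play) (A H) ⁅ i ⁆ ⟩
          bound c ⁅ i ⁆ + 1ℝ          ≲⟨ bound-⁅⁆ c 0<c i ⟩
          (c + 1ℝ) * ln (suc p) + (1ℝ + 1ℝ) * (c + 1ℝ) ∎
        -- Pouring only raises heights, so the bound after the adversary's next move also covers the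
        -- moment before it.
        h≤filled : ∀ i → h i ≤ filled (A H) i
        h≤filled i = begin
          h i                     ≈⟨ mk≐ (λ n → sym (ℚ.+-identityʳ (seq (h i) n))) ⟩
          h i + 0ℝ                ≲⟨ +-mono-≤ ≤-refl (pour-nonNeg (A H) i) ⟩
          filled (A H) i          ∎
    in (λ i → ≤-trans (h≤filled i) (filled≤ i)) , filled≤
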